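{- Let $k\ge 1$. Let $\nu(m,r,s,u)$ be the formal power series in $r$ satisfying $$f(rs)\,\nu(m,r,s,u)=1-g(rs)\prod_{j=0}^{k}\nu(m,rs^{j},s,u),$$ where $f(x)=1+x(m-1)$ and $g(x)=x(m(u-1)+1)$. Then $$\nu(m,r,s,u)=\sum_{n\ge 0}(-rs)^{n}\sum_{\mu\in\mathtt{Dyck}(n;k)}s^{|Y(\mu_{0}/\mu)|}\,\mathrm{wt}^{I}(k;\mu).$$
   Context: $m,s,u$ are formal variables, $m'=m-1$, $u'=u-1$, and power series in $r$ have coefficients in $\mathbb{Z}[m,s,u]$. A $k$-Dyck path of size $n$ is a lattice path from $(0,0)$ to $(kn,n)$ consisting of up steps $U=(0,1)$ and down steps $D=(1,0)$ which never goes below the line $y=x/k$; $\mathtt{Dyck}(n;k)$ is the set of them. $\mu_0=(UD^k)^n$ is the lowest path, and $|Y(\mu_0/\mu)|$ is the number of unit boxes above $\mu_0$ and below $\mu$. $\mathrm{Peak}(k;\mu)$ is the number of occurrences of the pattern $UD^{k}$ (consecutive steps) in $\mu$. For $\mu\in\mathtt{Dyck}(n;k)$, $$\mathrm{wt}^{I}(k;\mu)=(m'+1)^{\mathrm{Peak}(k;\mu)}(u'+1)^{\mathrm{Peak}(k;\mu)}(m'u'+u'+1)^{n-\mathrm{Peak}(k;\mu)}.$$ -}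

module Defs where

open import Algebra.Bundles using (CommutativeRing; RawRing)
open import Algebra.Morphism.Structures using (IsRingMonomorphism)
import Algebra.Construct.Pointwise as Pointwise
import Algebra.Morphism.RingMonomorphism as RingMonomorphism
import Algebra.Properties.CommutativeMonoid.Sum as MonoidSum
import Algebra.Properties.Ring as RingProperties
import Algebra.Properties.Semiring.Exp as SemiringExp
import Algebra.Properties.Semiring.Sum as SemiringSum
open import Data.Fin.Base using (toℕ)
import Data.Integer.Properties as ℤ
open import Data.List.Base
  using (List; []; _∷_; _++_; length; map; filter; foldl; foldr; concat;
         replicate; tails; upTo; cartesianProduct)
open import Data.List.Scans.Base using (scanl)
open import Data.List.Relation.Binary.Prefix.Heterogeneous.Properties using (prefix?)
open import Data.List.Relation.Unary.All using (All; all?)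
open import Data.Nat.Base using (ℕ; zero; suc; _∸_; _⊔_; _≤_; _<_; s≤s)
  renaming (_+_ to _+ℕ_; _*_ to _*ℕ_)
import Data.Nat.Properties as ℕ
open import Data.Product.Base using (_×_; _,_; proj₁; proj₂)
open import Data.Product.Properties using (≡-dec)
open import Data.Sum.Base using (_⊎_; inj₁; inj₂)
import Level
open import Relation.Binary.Definitions using (DecidableEquality)
open import Relation.Binary.PropositionalEquality.Core as ≡ using (_≡_)
import Relation.Binary.Reasoning.Setoid as SetoidReasoning
open import Relation.Nullary.Decidable using (Dec; yes; no; _×-dec_)

module PowerSeries {c ℓ} (R : CommutativeRing c ℓ) where

  open CommutativeRing R
  open SemiringSum semiring
  open SemiringExp semiring using (_^_)
  open SetoidReasoning setoid

  Series : Set c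
  Series = ℕ → Carrier

  infix 4 _≋_
  _≋_ : Series → Series → Set ℓ
  a ≋ b = ∀ n → a n ≈ b n

  infixl 6 _⊞_
  _⊞_ : Series → Series → Series
  (a ⊞ b) n = a n + b n

  infixl 7 _⊠_
  _⊠_ : Series → Series → Series
  (a ⊠ b) n = ∑[ i ≤ n ] (a (toℕ i) * b (n ∸ toℕ i))

  infix 8 ⊟_
  ⊟_ : Series → Series
  (⊟ a) n = - (a n)

  constant : Carrier → Series
  constant x zero    = x
  constant x (suc _) = 0#

  variable-r : Series
  variable-r 1 = 1#
  variable-r _ = 0#

  -- a [ x r] is the series a(xr), obtained from a(r) by r ↦ xr.
  infix 9 _[_r]
  _[_r] : Series → Carrier → Series
  (a [ x r]) n = x ^ n * a n

  shift : Series → Series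
  shift a n = a (suc n)

  ⊠-cong : ∀ {a b a′ b′} → a ≋ a′ → b ≋ b′ → a ⊠ b ≋ a′ ⊠ b′
  ⊠-cong a≋ b≋ n = sum-cong-≋ {suc n} λ i → *-cong (a≋ (toℕ i)) (b≋ (n ∸ toℕ i))

  scale-⊠ : ∀ x a b → (λ n → x * a n) ⊠ b ≋ (λ n → x * (a ⊠ b) n)
  scale-⊠ x a b n = begin
    ∑[ i ≤ n ] (x * a (toℕ i) * b (n ∸ toℕ i))
      ≈⟨ sum-cong-≋ {suc n} (λ i → *-assoc x (a (toℕ i)) (b (n ∸ toℕ i))) ⟩
    ∑[ i ≤ n ] (x * (a (toℕ i) * b (n ∸ toℕ i)))
      ≈⟨ *-distribˡ-sum {suc n} x (λ i → a (toℕ i) * b (n ∸ toℕ i)) ⟨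
    x * (a ⊠ b) n ∎

  ⊠-distribʳ : ∀ c a b → (a ⊞ b) ⊠ c ≋ a ⊠ c ⊞ b ⊠ c
  ⊠-distribʳ c a b n = begin
    ((a ⊞ b) ⊠ c) n
      ≈⟨ sum-cong-≋ {suc n} (λ i → distribʳ (c (n ∸ toℕ i)) (a (toℕ i)) (b (toℕ i))) ⟩
    ∑[ i ≤ n ] (a (toℕ i) * c (n ∸ toℕ i) + b (toℕ i) * c (n ∸ toℕ i))
      ≈⟨ ∑-distrib-+ {suc n} (λ i → a (toℕ i) * c (n ∸ toℕ i))
                             (λ i → b (toℕ i) * c (n ∸ toℕ i)) ⟩
    (a ⊠ c ⊞ b ⊠ c) n ∎

  ⊠-sucʳ : ∀ a b n → (a ⊠ b) (suc n) ≈ (a ⊠ shift b) n + a (suc n) * b 0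
  ⊠-sucʳ a b zero    = begin
    a 0 * b 1 + (a 1 * b 0 + 0#) ≈⟨ +-congˡ (+-identityʳ _) ⟩
    a 0 * b 1 + a 1 * b 0        ≈⟨ +-congʳ (+-identityʳ _) ⟨
    a 0 * b 1 + 0# + a 1 * b 0   ∎
  ⊠-sucʳ a b (suc n) = begin
    a 0 * b (suc (suc n)) + (shift a ⊠ b) (suc n)
      ≈⟨ +-congˡ (⊠-sucʳ (shift a) b n) ⟩
    a 0 * b (suc (suc n)) + ((shift a ⊠ shift b) n + a (suc (suc n)) * b 0)
      ≈⟨ +-assoc _ _ _ ⟨
    (a ⊠ shift b) (suc n) + a (suc (suc n)) * b 0 ∎

  ⊠-comm : ∀ a b → a ⊠ b ≋ b ⊠ a
  ⊠-comm a b zero    = +-congʳ (*-comm (a 0) (b 0))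
  ⊠-comm a b (suc n) = begin
    a 0 * b (suc n) + (shift a ⊠ b) n ≈⟨ +-cong (*-comm _ _) (⊠-comm (shift a) b n) ⟩
    b (suc n) * a 0 + (b ⊠ shift a) n ≈⟨ +-comm _ _ ⟩
    (b ⊠ shift a) n + b (suc n) * a 0 ≈⟨ ⊠-sucʳ b a n ⟨
    (b ⊠ a) (suc n)                   ∎

  ⊠-assoc : ∀ a b c → (a ⊠ b) ⊠ c ≋ a ⊠ (b ⊠ c)
  ⊠-assoc a b c zero    = begin
    (a 0 * b 0 + 0#) * c 0 + 0# ≈⟨ +-congʳ (*-congʳ (+-identityʳ _)) ⟩
    a 0 * b 0 * c 0 + 0#        ≈⟨ +-congʳ (*-assoc _ _ _) ⟩
    a 0 * (b 0 * c 0) + 0#      ≈⟨ +-congʳ (*-congˡ (+-identityʳ _)) ⟨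
    a 0 * (b 0 * c 0 + 0#) + 0# ∎
  ⊠-assoc a b c (suc n) = begin
    (a 0 * b 0 + 0#) * c (suc n) + (((λ i → a 0 * shift b i) ⊞ shift a ⊠ b) ⊠ c) n
      ≈⟨ +-cong (trans (*-congʳ (+-identityʳ _)) (*-assoc _ _ _))
                (⊠-distribʳ c (λ i → a 0 * shift b i) (shift a ⊠ b) n) ⟩
    a 0 * (b 0 * c (suc n))
      + (((λ i → a 0 * shift b i) ⊠ c) n + ((shift a ⊠ b) ⊠ c) n)
      ≈⟨ +-congˡ (+-cong (scale-⊠ (a 0) (shift b) c n) (⊠-assoc (shift a) b c n)) ⟩
    a 0 * (b 0 * c (suc n)) + (a 0 * (shift b ⊠ c) n + (shift a ⊠ (b ⊠ c)) n)
      ≈⟨ +-assoc _ _ _ ⟨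
    a 0 * (b 0 * c (suc n)) + a 0 * (shift b ⊠ c) n + (shift a ⊠ (b ⊠ c)) n
      ≈⟨ +-congʳ (distribˡ (a 0) _ _) ⟨
    (a ⊠ (b ⊠ c)) (suc n) ∎

  zero-⊠ : ∀ b n → ((λ _ → 0#) ⊠ b) n ≈ 0#
  zero-⊠ b n = trans (sum-cong-≋ {suc n} (λ i → zeroˡ (b (n ∸ toℕ i))))
                     (sum-replicate-zero (suc n))

  ⊠-identityˡ : ∀ a → constant 1# ⊠ a ≋ a
  ⊠-identityˡ a zero    = trans (+-identityʳ _) (*-identityˡ _)
  ⊠-identityˡ a (suc n) =
    trans (+-cong (*-identityˡ _) (zero-⊠ a n)) (+-identityʳ _)

  seriesRawRing : RawRing c ℓ
  seriesRawRing = record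
    { Carrier = Series ; _≈_ = _≋_ ; _+_ = _⊞_ ; _*_ = _⊠_ ; -_ = ⊟_
    ; 0# = λ _ → 0# ; 1# = constant 1# }

  seriesRing : CommutativeRing c ℓ
  seriesRing = record
    { RawRing seriesRawRing
    ; isCommutativeRing = record
      { isRing = record
        { +-isAbelianGroup = Pointwise.isAbelianGroup ℕ +-isAbelianGroup
        ; *-cong           = λ {a} {a′} {b} {b′} → ⊠-cong {a} {b} {a′} {b′}
        ; *-assoc          = ⊠-assoc
        ; *-identity       = ⊠-identityˡ
                           , λ a n → trans (⊠-comm a (constant 1#) n) (⊠-identityˡ a n)
        ; distrib          =
            (λ a b c n → trans (⊠-comm a (b ⊞ c) n)
                       (trans (⊠-distribʳ a b c n)
                              (+-cong (⊠-comm b a n) (⊠-comm c a n))))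
          , ⊠-distribʳ
        }
      ; *-comm = ⊠-comm
      }
    }

-- Polynomials as the subring of finitely supported series.
module Polynomial {c ℓ} (R : CommutativeRing c ℓ) where

  open CommutativeRing R
  open SemiringSum semiring
  open RingProperties ring using (-0#≈0#)
  open PowerSeries R

  record Poly : Set (c Level.⊔ ℓ) where
    field
      coeff   : Series
      bound   : ℕ
      support : ∀ n → bound ≤ n → coeff n ≈ 0#

  open Poly

  split : ∀ p q n i → p +ℕ q ≤ n → (p ≤ i) ⊎ (q ≤ n ∸ i)
  split p q n i p+q≤n with ℕ.≤-total p i
  ... | inj₁ p≤i = inj₁ p≤i
  ... | inj₂ i≤p = inj₂ (ℕ.≤-trans q≤n∸p (ℕ.∸-monoʳ-≤ n i≤p))
    where
    q≤n∸p : q ≤ n ∸ p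
    q≤n∸p = ℕ.m+n≤o⇒m≤o∸n q (≡.subst (_≤ n) (ℕ.+-comm p q) p+q≤n)

  ⊠-support : ∀ p q n → bound p +ℕ bound q ≤ n → (coeff p ⊠ coeff q) n ≈ 0#
  ⊠-support p q n le =
    trans (sum-cong-≋ {suc n} (λ i → term (toℕ i))) (sum-replicate-zero (suc n))
    where
    term : ∀ i → coeff p i * coeff q (n ∸ i) ≈ 0#
    term i with split (bound p) (bound q) n i le
    ... | inj₁ x = trans (*-congʳ (support p i x)) (zeroˡ _)
    ... | inj₂ y = trans (*-congˡ (support q (n ∸ i) y)) (zeroʳ _)

  constantPoly : Carrier → Poly
  constantPoly x = record
    { coeff = constant x ; bound = 1 ; support = λ { (suc n) _ → refl } }

  variablePoly : Poly
  variablePoly = record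
    { coeff = variable-r ; bound = 2
    ; support = λ { (suc (suc n)) _ → refl ; 1 (s≤s ()) } }

  polyRawRing : RawRing (c Level.⊔ ℓ) ℓ
  polyRawRing = record
    { Carrier = Poly
    ; _≈_ = λ p q → coeff p ≋ coeff q
    ; _+_ = λ p q → record
        { coeff = coeff p ⊞ coeff q
        ; bound = bound p ⊔ bound q
        ; support = λ n le → trans
            (+-cong (support p n (ℕ.≤-trans (ℕ.m≤m⊔n (bound p) (bound q)) le))
                    (support q n (ℕ.≤-trans (ℕ.m≤n⊔m (bound p) (bound q)) le)))
            (+-identityˡ 0#) }
    ; _*_ = λ p q → record
        { coeff = coeff p ⊠ coeff q
        ; bound = bound p +ℕ bound q
        ; support = ⊠-support p q }
    ; -_ = λ p → record
        { coeff = ⊟ coeff p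
        ; bound = bound p
        ; support = λ n le → trans (-‿cong (support p n le)) -0#≈0# }
    ; 0# = record { coeff = λ _ → 0# ; bound = 0 ; support = λ _ _ → refl }
    ; 1# = constantPoly 1#
    }

  coeff-isRingMonomorphism : IsRingMonomorphism polyRawRing seriesRawRing coeff
  coeff-isRingMonomorphism = record
    { isRingHomomorphism = record
      { isSemiringHomomorphism = record
        { isNearSemiringHomomorphism = record
          { +-isMonoidHomomorphism = record
            { isMagmaHomomorphism = record
              { isRelHomomorphism = record { cong = λ p≈q → p≈q }
              ; homo = λ _ _ _ → refl }
            ; ε-homo = λ _ → refl }
          ; *-homo = λ _ _ _ → refl }
        ; 1#-homo = λ _ → refl }
      ; -‿homo = λ _ _ → refl }
    ; injective = λ p≈q → p≈q }

  polyRing : CommutativeRing (c Level.⊔ ℓ) ℓ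
  polyRing = record
    { RawRing polyRawRing
    ; isCommutativeRing =
        RingMonomorphism.isCommutativeRing coeff-isRingMonomorphism
          (CommutativeRing.isCommutativeRing seriesRing)
    }

open Polynomial using (polyRing; constantPoly; variablePoly)

-- ℤ[m,s,u] is built as ((ℤ[m])[s])[u].

ℤ[m] ℤ[m,s] ℤ[m,s,u] : CommutativeRing Level.0ℓ Level.0ℓ
ℤ[m]     = polyRing ℤ.+-*-commutativeRing
ℤ[m,s]   = polyRing ℤ[m]
ℤ[m,s,u] = polyRing ℤ[m,s]

var-m var-s var-u : CommutativeRing.Carrier ℤ[m,s,u]
var-m = constantPoly ℤ[m,s] (constantPoly ℤ[m] (variablePoly ℤ.+-*-commutativeRing))
var-s = constantPoly ℤ[m,s] (variablePoly ℤ[m])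
var-u = variablePoly ℤ[m,s]

data Step : Set where
  U D : Step

_≟ˢ_ : DecidableEquality Step
U ≟ˢ U = yes ≡.refl
U ≟ˢ D = no λ ()
D ≟ˢ U = no λ ()
D ≟ˢ D = yes ≡.refl

move : ℕ × ℕ → Step → ℕ × ℕ
move (x , y) U = x , suc y
move (x , y) D = suc x , y

-- y ≥ x/k is written x ≤ k * y.  The half-plane is convex, so it is enough
-- to check the lattice points of the path.
IsDyck : (n k : ℕ) → List Step → Set
IsDyck n k μ = All (λ (x , y) → x ≤ k *ℕ y) (scanl move (0 , 0) μ)
             × foldl move (0 , 0) μ ≡ (k *ℕ n , n)

isDyck? : ∀ n k μ → Dec (IsDyck n k μ)
isDyck? n k μ = all? (λ (x , y) → x ℕ.≤? k *ℕ y) (scanl move (0 , 0) μ)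
          ×-dec ≡-dec ℕ._≟_ ℕ._≟_ (foldl move (0 , 0) μ) (k *ℕ n , n)

words : ℕ → List (List Step)
words zero    = [] ∷ []
words (suc ℓ) = map (U ∷_) (words ℓ) ++ map (D ∷_) (words ℓ)

-- A path to (kn , n) has n + kn steps, so every Dyck path is listed exactly once.
Dyck : (n k : ℕ) → List (List Step)
Dyck n k = filter (isDyck? n k) (words (n +ℕ k *ℕ n))

lowest : (n k : ℕ) → List Step
lowest n k = concat (replicate n (U ∷ replicate k D))

-- The ordinate of the down step from abscissa i to i + 1; the value at an i
-- beyond the end of the path is irrelevant.
height : List Step → ℕ → ℕ
height []      _       = 0
height (U ∷ μ) i       = suc (height μ i)
height (D ∷ μ) zero    = 0
height (D ∷ μ) (suc i) = height μ i

-- |Y(μ₀/μ)|.  The pair (i , j) stands for the box [i , i+1] × [j , j+1]; it is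
-- above a path when j ≥ height i and below it when j + 1 ≤ height i.
area : (n k : ℕ) → List Step → ℕ
area n k μ = length (filter between? (cartesianProduct (upTo (k *ℕ n)) (upTo n)))
  where
  between? : (b : ℕ × ℕ) →
             Dec (height (lowest n k) (proj₁ b) ≤ proj₂ b × proj₂ b < height μ (proj₁ b))
  between? (i , j) = (height (lowest n k) i ℕ.≤? j) ×-dec (j ℕ.<? height μ i)

Peak : (k : ℕ) → List Step → ℕ
Peak k μ = length (filter (prefix? _≟ˢ_ (U ∷ replicate k D)) (tails μ))

-- m, s, u are elements of any commutative ring here; at the end of the file they
-- are taken to be the variables of ℤ[m,s,u].
module Identity {c ℓ} (R : CommutativeRing c ℓ) (m s u : CommutativeRing.Carrier R) where

  open CommutativeRing R
  open SemiringExp semiring using (_^_)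
  open PowerSeries R using (Series; constant; variable-r; _[_r])

  module S = CommutativeRing (PowerSeries.seriesRing R)

  open MonoidSum S.*-commutativeMonoid using () renaming (sum to product)

  m′ u′ : Carrier
  m′ = m - 1#
  u′ = u - 1#

  wtᴵ : (n k : ℕ) → List Step → Carrier
  wtᴵ n k μ = (m′ + 1#) ^ Peak k μ
            * (u′ + 1#) ^ Peak k μ
            * (m′ * u′ + u′ + 1#) ^ (n ∸ Peak k μ)

  f g : Series
  f = S.1# S.+ variable-r S.* constant (m - 1#)
  g = variable-r S.* constant (m * (u - 1#) + 1#)

  Satisfies : (k : ℕ) → Series → Set ℓ
  Satisfies k ν =
    f [ s r] S.* ν S.≈ S.1# S.- g [ s r] S.* product {suc k} (λ j → ν [ s ^ toℕ j r])

  sumOver : ∀ {a} {A : Set a} → List A → (A → Carrier) → Carrier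
  sumOver xs h = foldr _+_ 0# (map h xs)

  -- The right-hand side is Σₙ xⁿ (dyckSum k n) at x = -rs.
  dyckSum : (k : ℕ) → Series
  dyckSum k n = sumOver (Dyck n k) (λ μ → s ^ area n k μ * wtᴵ n k μ)

  dyckSeries : (k : ℕ) → Series
  dyckSeries k = dyckSum k [ - s r]

open Identity ℤ[m,s,u] var-m var-s var-u public using (Satisfies; dyckSeries)
open PowerSeries ℤ[m,s,u] public using (Series; _≋_)

{-# OPTIONS --safe #-}
module Submission where

-- Give the lattice point (x , y) the altitude k y − x, and let Hₕ(t) be the weighted
-- sum over the paths which start at the altitude h, never go below 0 and end at 0,
-- where t = −rs marks the up steps and an up step at the altitude h weighs sʰ (its
-- row of boxes) times m u if it starts a peak UDᵏ and c = m′u′+u′+1 otherwise.  As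
-- m u = c + m′, looking at the first step gives
--   H₀ = 1 + t E₀,   Hₕ₊₁ = Hₕ + sʰ⁺¹ t Eₕ₊₁,   where Eₕ = c Hₖ₊ₕ + m′ Hₕ,
-- and this recurrence implies Hₕ₊₁(t) = Hₕ(st) H₀(t).  Hence Hₖ = ∏ⱼ H₀(sʲt), and the
-- equation for H₀ is the functional equation.

open import Defs hiding (Satisfies; dyckSeries; Series; _≋_)
open import Algebra.Bundles using (CommutativeRing)
import Algebra.Properties.CommutativeMonoid.Sum as MonoidSum
import Algebra.Properties.CommutativeSemiring.Exp as Exp
import Algebra.Properties.Ring as RingProperties
import Algebra.Solver.Ring.NaturalCoefficients.Default as Solver
open import Data.Bool.Base using (Bool; true; false; if_then_else_)
open import Data.Empty using (⊥)
open import Data.Fin.Base as Fin using (toℕ)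
open import Data.List.Base
  using (List; []; _∷_; _++_; length; map; filter; foldl; replicate; inits;
         applyUpTo; upTo; cartesianProduct)
open import Data.List.Properties
  using (length-++; map-∘; filter-++; filter-accept; filter-reject; map-upTo)
open import Data.List.Relation.Binary.Prefix.Heterogeneous.Properties using (prefix?)
open import Data.List.Relation.Unary.All as All using (All; []; _∷_)
import Data.List.Relation.Unary.All.Properties as All
open import Data.List.Scans.Base using (scanl)
open import Data.List.Scans.Properties using (scanl-defn)
open import Data.Nat.Base using (ℕ; zero; suc; _∸_; _≤_; z≤n; s≤s)
  renaming (_+_ to _+ℕ_; _*_ to _*ℕ_)
open import Data.Nat.ListAction using (sum)
import Data.Nat.Properties as ℕ
open import Data.Nat.Solver using (module +-*-Solver)
open import Data.Product using (_×_; _,_; proj₁; proj₂; ∃!)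
open import Data.Sum.Base using (inj₁; inj₂)
open import Function.Base using (_∘_; id)
open import Function.Bundles using (_⇔_; mk⇔; module Equivalence)
import Level
open import Relation.Binary.PropositionalEquality as ≡ using (_≡_)
import Relation.Binary.Reasoning.Setoid as SetoidReasoning
open import Relation.Nullary using (yes; no; does; ¬_; contradiction)
open import Relation.Nullary.Decidable using (_×-dec_)
open import Relation.Unary using (Pred; Decidable)

-- Lattice paths as words with an altitude.

module LatticePaths where

  open import Data.Nat.Base
  open import Data.Nat.Properties
  open import Relation.Binary.PropositionalEquality
    using (refl; sym; trans; cong; cong₂; subst; module ≡-Reasoning)

  -- Both sides are folds over initial segments, and the nonempty initial segments of `x ∷ xs` all
  -- begin with `x`.
  scanl-∷ : ∀ {A B : Set} (f : A → B → A) e x xs →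
            scanl f e (x ∷ xs) ≡ e ∷ scanl f (f e x) xs
  scanl-∷ f e x xs = begin
    scanl f e (x ∷ xs)                             ≡⟨ scanl-defn f e (x ∷ xs) ⟩
    e ∷ map (foldl f e) (map (x ∷_) (inits xs))    ≡⟨ cong (e ∷_) (map-∘ (inits xs)) ⟨
    e ∷ map (foldl f (f e x)) (inits xs)           ≡⟨ cong (e ∷_) (scanl-defn f (f e x) xs) ⟨
    e ∷ scanl f (f e x) xs                         ∎
    where open ≡-Reasoning

  length-words : ∀ ℓ → All (λ w → length w ≡ ℓ) (words ℓ)
  length-words zero    = refl ∷ []
  length-words (suc ℓ) = All.++⁺ (All.map⁺ (All.map (cong suc) (length-words ℓ)))
                                 (All.map⁺ (All.map (cong suc) (length-words ℓ)))

  ups downs : List Step → ℕ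
  ups []        = 0
  ups (U ∷ w)   = suc (ups w)
  ups (D ∷ w)   = ups w
  downs []      = 0
  downs (U ∷ w) = downs w
  downs (D ∷ w) = suc (downs w)

  length≡ups+downs : ∀ w → length w ≡ ups w + downs w
  length≡ups+downs []      = refl
  length≡ups+downs (U ∷ w) = cong suc (length≡ups+downs w)
  length≡ups+downs (D ∷ w) =
    trans (cong suc (length≡ups+downs w)) (sym (+-suc (ups w) (downs w)))

  foldl-move : ∀ x y w → foldl move (x , y) w ≡ (x + downs w , y + ups w)
  foldl-move x y []      = cong₂ _,_ (sym (+-identityʳ x)) (sym (+-identityʳ y))
  foldl-move x y (U ∷ w) = trans (foldl-move x (suc y) w) (cong (x + downs w ,_) (sym (+-suc y (ups w))))
  foldl-move x y (D ∷ w) = trans (foldl-move (suc x) y w) (cong (_, y + ups w) (sym (+-suc x (downs w))))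

  -- Distinct occurrences of the pattern begin at distinct up steps. The bound keeps the truncated
  -- subtraction in `wtᴵ` exact.
  Peak≤ups : ∀ k w → Peak k w ≤ ups w
  Peak≤ups k []      = z≤n
  Peak≤ups k (U ∷ w) with prefix? _≟ˢ_ (replicate k D) w
  ... | yes _ = s≤s (Peak≤ups k w)
  ... | no _  = m≤n⇒m≤1+n (Peak≤ups k w)
  Peak≤ups k (D ∷ w) = Peak≤ups k w

  module _ (k : ℕ) where

    -- The word w is read as a path that starts at the altitude h.
    Descends : ℕ → List Step → Set
    Descends h       []      = h ≡ 0
    Descends h       (U ∷ w) = Descends (k + h) w
    Descends zero    (D ∷ w) = ⊥
    Descends (suc h) (D ∷ w) = Descends h w

    -- The row of boxes between μ₀ and an up step of μ has as many boxes as the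
    -- altitude of that step.
    altitudeSum : ℕ → List Step → ℕ
    altitudeSum h       []      = 0
    altitudeSum h       (U ∷ w) = h + altitudeSum (k + h) w
    altitudeSum zero    (D ∷ w) = 0
    altitudeSum (suc h) (D ∷ w) = altitudeSum h w

    -- An up step raises the altitude by `k`, a down step lowers it by 1, and the path ends at the
    -- altitude 0.
    downs-Descends : ∀ h w → Descends h w → downs w ≡ h + k * ups w
    downs-Descends h       []      h≡0 = sym (cong₂ _+_ h≡0 (*-zeroʳ k))
    downs-Descends h       (U ∷ w) d   = begin
      downs w              ≡⟨ downs-Descends (k + h) w d ⟩
      k + h + k * ups w    ≡⟨ solve 3 (λ a b c → a :+ b :+ a :* c := b :+ a :* (con 1 :+ c)) refl k h (ups w) ⟩
      h + k * suc (ups w)  ∎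
      where open ≡-Reasoning
            open +-*-Solver
    downs-Descends (suc h) (D ∷ w) d   = cong suc (downs-Descends h w d)

    AboveDiagonal : ℕ × ℕ → Set
    AboveDiagonal (x , y) = x ≤ k * y

    private
      altitude-U : ∀ x y {h} → x + h ≡ k * y → x + (k + h) ≡ k * suc y
      altitude-U x y {h} eq = begin
        x + (k + h)   ≡⟨ solve 3 (λ a b c → a :+ (b :+ c) := b :+ (a :+ c)) refl x k h ⟩
        k + (x + h)   ≡⟨ cong (k +_) eq ⟩
        k + k * y     ≡⟨ *-suc k y ⟨
        k * suc y     ∎
        where open ≡-Reasoning
              open +-*-Solver

      altitude-D : ∀ x y {h} → x + suc h ≡ k * y → suc x + h ≡ k * y
      altitude-D x y {h} eq = trans (sym (+-suc x h)) eq

    -- The invariant `x + h ≡ k * y` makes `h` the altitude of the current point, so a point is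
    -- above the diagonal exactly when such a natural number `h` exists.
    IsDyck⇒Descends : ∀ {N} x y h w → x + h ≡ k * y →
      All AboveDiagonal (scanl move (x , y) w) → foldl move (x , y) w ≡ (k * N , N) →
      Descends h w
    IsDyck⇒Descends x y h [] eq _ refl = +-cancelˡ-≡ x h 0 (trans eq (sym (+-identityʳ x)))
    IsDyck⇒Descends x y h (U ∷ w) eq above end
      with _ ∷ above′ ← subst (All AboveDiagonal) (scanl-∷ move (x , y) U w) above
      = IsDyck⇒Descends x (suc y) (k + h) w (altitude-U x y eq) above′ end
    -- At the altitude 0 the point satisfies x = k y, so a down step would leave the half-plane.
    IsDyck⇒Descends x y zero (D ∷ w) eq (_ ∷ sx≤ky ∷ _) end =
      contradiction (subst (suc x ≤_) (trans (sym eq) (+-identityʳ x)) sx≤ky) 1+n≰n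
    IsDyck⇒Descends x y (suc h) (D ∷ w) eq above end
      with _ ∷ above′ ← subst (All AboveDiagonal) (scanl-∷ move (x , y) D w) above
      = IsDyck⇒Descends (suc x) y h w (altitude-D x y eq) above′ end

    Descends⇒above : ∀ x y h w → x + h ≡ k * y → Descends h w →
      All AboveDiagonal (scanl move (x , y) w)
    Descends⇒above x y h [] eq d = m+n≤o⇒m≤o x (≤-reflexive eq) ∷ []
    Descends⇒above x y h (U ∷ w) eq d =
      subst (All AboveDiagonal) (sym (scanl-∷ move (x , y) U w))
        (m+n≤o⇒m≤o x (≤-reflexive eq) ∷ Descends⇒above x (suc y) (k + h) w (altitude-U x y eq) d)
    Descends⇒above x y (suc h) (D ∷ w) eq d =
      subst (All AboveDiagonal) (sym (scanl-∷ move (x , y) D w))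
        (m+n≤o⇒m≤o x (≤-reflexive eq) ∷ Descends⇒above (suc x) y h w (altitude-D x y eq) d)

    -- From the altitude 0 the length is (k + 1) times the number of up steps, so the length
    -- determines that number.
    Descends⇒ups : ∀ n w → length w ≡ n + k * n → Descends 0 w → ups w ≡ n
    Descends⇒ups n w len d = *-cancelˡ-≡ (ups w) n (suc k) (begin
      ups w + k * ups w  ≡⟨ cong (ups w +_) (downs-Descends 0 w d) ⟨
      ups w + downs w    ≡⟨ length≡ups+downs w ⟨
      length w           ≡⟨ len ⟩
      n + k * n          ∎)
      where open ≡-Reasoning

    -- A word of this length that descends to the altitude 0 has n up steps and k n down steps,
    -- which fixes its end point.
    IsDyck⇔Descends : ∀ n w → length w ≡ n + k * n → IsDyck n k w ⇔ Descends 0 w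
    IsDyck⇔Descends n w len = mk⇔
      (λ (above , end) → IsDyck⇒Descends 0 0 0 w (sym (*-zeroʳ k)) above end)
      (λ d → Descends⇒above 0 0 0 w (sym (*-zeroʳ k)) d , (begin
        foldl move (0 , 0) w      ≡⟨ foldl-move 0 0 w ⟩
        (downs w , ups w)         ≡⟨ cong (_, ups w) (downs-Descends 0 w d) ⟩
        (k * ups w , ups w)       ≡⟨ cong (λ j → (k * j , j)) (Descends⇒ups n w len d) ⟩
        (k * n , n)               ∎))
      where open ≡-Reasoning

  -- Counting boxes: the area as a sum of altitudes.

  length-filter-map : ∀ {A B : Set} {P : Pred B Level.zero} (P? : Decidable P) (g : A → B) xs →
                      length (filter P? (map g xs)) ≡ length (filter (P? ∘ g) xs)
  length-filter-map P? g []       = refl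
  length-filter-map P? g (x ∷ xs) with does (P? (g x))
  ... | true  = cong suc (length-filter-map P? g xs)
  ... | false = length-filter-map P? g xs

  length-filter-cartesianProduct :
    ∀ {A B : Set} {P : Pred (A × B) Level.zero} (P? : Decidable P) xs ys →
    length (filter P? (cartesianProduct xs ys))
      ≡ sum (map (λ x → length (filter (λ y → P? (x , y)) ys)) xs)
  length-filter-cartesianProduct P? []       ys = refl
  length-filter-cartesianProduct P? (x ∷ xs) ys = begin
    length (filter P? (map (x ,_) ys ++ rest))
      ≡⟨ cong length (filter-++ P? (map (x ,_) ys) rest) ⟩
    length (filter P? (map (x ,_) ys) ++ filter P? rest)
      ≡⟨ length-++ (filter P? (map (x ,_) ys)) ⟩
    length (filter P? (map (x ,_) ys)) + length (filter P? rest)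
      ≡⟨ cong₂ _+_ (length-filter-map P? (x ,_) ys) (length-filter-cartesianProduct P? xs ys) ⟩
    length (filter (λ y → P? (x , y)) ys) + sum (map _ xs) ∎
    where open ≡-Reasoning
          rest = cartesianProduct xs ys

  -- Peeling off the index 0 shifts the interval down by one and replaces `g` by `g ∘ suc`. Hence
  -- `g` is general and the predicate is tied to the interval only through an equivalence. The
  -- additive form avoids a subtraction.
  length-filter-interval :
    ∀ {a b} n (g : ℕ → ℕ) {P : Pred ℕ Level.zero} (P? : Decidable P) →
    (∀ j → P (g j) ⇔ (a ≤ j × j < b)) → a ≤ b → b ≤ n →
    length (filter P? (applyUpTo g n)) + a ≡ b
  length-filter-interval zero g P? P⇔ z≤n z≤n = refl
  length-filter-interval {zero} {zero} (suc n) g P? P⇔ z≤n z≤n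
    rewrite filter-reject P? {g 0} {applyUpTo (g ∘ suc) n}
              (λ p → n≮0 (proj₂ (Equivalence.to (P⇔ 0) p)))
    = length-filter-interval n (g ∘ suc) P?
        (λ j → mk⇔ (λ p → contradiction (proj₂ (Equivalence.to (P⇔ (suc j)) p)) n≮0) λ ())
        z≤n z≤n
  length-filter-interval {zero} {suc b} (suc n) g P? P⇔ z≤n (s≤s b≤n)
    rewrite filter-accept P? {g 0} {applyUpTo (g ∘ suc) n} (Equivalence.from (P⇔ 0) (z≤n , z<s))
    = cong suc (length-filter-interval n (g ∘ suc) P?
        (λ j → mk⇔ (λ p → z≤n , s<s⁻¹ (proj₂ (Equivalence.to (P⇔ (suc j)) p)))
                   (λ (_ , j<b) → Equivalence.from (P⇔ (suc j)) (z≤n , s<s j<b)))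
        z≤n b≤n)
  length-filter-interval {suc a} {suc b} (suc n) g P? P⇔ (s≤s a≤b) (s≤s b≤n)
    rewrite filter-reject P? {g 0} {applyUpTo (g ∘ suc) n}
              (λ p → n≮0 (proj₁ (Equivalence.to (P⇔ 0) p)))
    = trans (+-suc _ a) (cong suc (length-filter-interval n (g ∘ suc) P?
        (λ j → mk⇔ (λ p → let a≤j , j<b = Equivalence.to (P⇔ (suc j)) p in s≤s⁻¹ a≤j , s<s⁻¹ j<b)
                   (λ (a≤j , j<b) → Equivalence.from (P⇔ (suc j)) (s≤s a≤j , s<s j<b)))
        a≤b b≤n))

  sum-applyUpTo-+ : ∀ {p q r : ℕ → ℕ} n → (∀ i → i < n → p i + q i ≡ r i) →
                    sum (applyUpTo p n) + sum (applyUpTo q n) ≡ sum (applyUpTo r n)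
  sum-applyUpTo-+ zero    _  = refl
  sum-applyUpTo-+ {p} {q} {r} (suc n) p+q≡r = begin
    p 0 + P + (q 0 + Q)  ≡⟨ solve 4 (λ a b c d → a :+ b :+ (c :+ d) := a :+ c :+ (b :+ d)) refl (p 0) P (q 0) Q ⟩
    p 0 + q 0 + (P + Q)  ≡⟨ cong₂ _+_ (p+q≡r 0 z<s) (sum-applyUpTo-+ n (λ i i<n → p+q≡r (suc i) (s<s i<n))) ⟩
    sum (applyUpTo r (suc n)) ∎
    where open ≡-Reasoning
          open +-*-Solver
          P = sum (applyUpTo (p ∘ suc) n)
          Q = sum (applyUpTo (q ∘ suc) n)

  sum-applyUpTo-const : ∀ c n → sum (applyUpTo (λ _ → c) n) ≡ n * c
  sum-applyUpTo-const c zero    = refl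
  sum-applyUpTo-const c (suc n) = cong (c +_) (sum-applyUpTo-const c n)

  height≤ups : ∀ w i → height w i ≤ ups w
  height≤ups []      i       = z≤n
  height≤ups (U ∷ w) i       = s≤s (height≤ups w i)
  height≤ups (D ∷ w) zero    = z≤n
  height≤ups (D ∷ w) (suc i) = height≤ups w i

  sumHeights : List Step → ℕ
  sumHeights w = sum (applyUpTo (height w) (downs w))

  -- The leading up step raises each of the `downs w` columns by one.
  sumHeights-U : ∀ w → sumHeights (U ∷ w) ≡ downs w + sumHeights w
  sumHeights-U w = trans (sym (sum-applyUpTo-+ (downs w) (λ _ _ → refl)))
    (cong (_+ sumHeights w) (trans (sum-applyUpTo-const 1 (downs w)) (*-identityʳ (downs w))))

  triangular : ℕ → ℕ
  triangular zero    = 0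
  triangular (suc n) = suc n + triangular n

  module _ (k : ℕ) where

    -- Count by rows: the row to the right of an up step at the altitude h covers all later columns,
    -- which number h + k j when j up steps remain, this one included. The parts k j add up to k
    -- times the triangular number.
    sumHeights-Descends : ∀ h w → Descends k h w →
      sumHeights w ≡ altitudeSum k h w + k * triangular (ups w)
    sumHeights-Descends h []      d = sym (*-zeroʳ k)
    sumHeights-Descends h (U ∷ w) d = begin
      sumHeights (U ∷ w)
        ≡⟨ sumHeights-U w ⟩
      downs w + sumHeights w
        ≡⟨ cong₂ _+_ (downs-Descends k h (U ∷ w) d) (sumHeights-Descends (k + h) w d) ⟩
      h + k * suc (ups w) + (altitudeSum k (k + h) w + k * triangular (ups w))
        ≡⟨ solve 5 (λ h k a b c → h :+ k :* a :+ (b :+ k :* c) := h :+ b :+ k :* (a :+ c)) refl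
             h k (suc (ups w)) (altitudeSum k (k + h) w) (triangular (ups w)) ⟩
      h + altitudeSum k (k + h) w + k * triangular (ups (U ∷ w)) ∎
      where open ≡-Reasoning
            open +-*-Solver
    sumHeights-Descends (suc h) (D ∷ w) d = sumHeights-Descends h w d

    -- A down step starts at a positive altitude, and in column `i` that altitude is
    -- `h + k * height w i` minus `i`.
    height-Descends : ∀ h w i → Descends k h w → i < downs w → i < h + k * height w i
    height-Descends h (U ∷ w) i d i<downs =
      subst (i <_) (solve 3 (λ k h a → k :+ h :+ k :* a := h :+ k :* (con 1 :+ a)) refl k h (height w i))
        (height-Descends (k + h) w i d i<downs)
      where open +-*-Solver
    height-Descends (suc h) (D ∷ w) zero    d _             = z<s
    height-Descends (suc h) (D ∷ w) (suc i) d (s≤s i<downs) = s<s (height-Descends h w i d i<downs)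

    height-downs++ : ∀ j {w} → (∀ i → k * height w i ≤ i + j) →
                     ∀ i → k * height (replicate j D ++ w) i ≤ i
    height-downs++ j bound i = ≤-trans
      (shifted j 0 (λ i → ≤-trans (bound i) (≤-reflexive (cong (i +_) (sym (+-identityʳ j))))) i)
      (≤-reflexive (+-identityʳ i))
      where
      -- The slack `e` counts the down steps already removed: each removal moves the columns left by
      -- one.
      shifted : ∀ j e {w} → (∀ i → k * height w i ≤ i + (j + e)) →
                ∀ i → k * height (replicate j D ++ w) i ≤ i + e
      shifted zero    e bound i       = bound i
      shifted (suc j) e bound zero    = subst (_≤ e) (sym (*-zeroʳ k)) z≤n
      shifted (suc j) e bound (suc i) = ≤-trans
        (shifted j (suc e) (λ i → ≤-trans (bound i) (≤-reflexive (cong (i +_) (sym (+-suc j e))))) i)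
        (≤-reflexive (+-suc i e))

    -- Each block UDᵏ raises the path by one and then passes k columns. The extra `k` on the right
    -- belongs to the block that contains column `i`.
    height-lowest : ∀ n i → k * height (lowest n k) i ≤ i + k
    height-lowest zero    i = subst (_≤ i + k) (sym (*-zeroʳ k)) z≤n
    height-lowest (suc n) i = begin
      k * suc (height w i)   ≡⟨ *-suc k (height w i) ⟩
      k + k * height w i     ≤⟨ +-monoʳ-≤ k (height-downs++ k (height-lowest n) i) ⟩
      k + i                  ≡⟨ +-comm k i ⟩
      i + k                  ∎
      where open ≤-Reasoning
            w = replicate k D ++ lowest n k

    Descends-downs++ : ∀ j h w → Descends k h w → Descends k (j + h) (replicate j D ++ w)
    Descends-downs++ zero    h w d = d
    Descends-downs++ (suc j) h w d = Descends-downs++ j h w d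

    Descends-lowest : ∀ n → Descends k 0 (lowest n k)
    Descends-lowest zero    = refl
    Descends-lowest (suc n) = Descends-downs++ k 0 (lowest n k) (Descends-lowest n)

    altitudeSum-downs++ : ∀ j h w →
      altitudeSum k (j + h) (replicate j D ++ w) ≡ altitudeSum k h w
    altitudeSum-downs++ zero    h w = refl
    altitudeSum-downs++ (suc j) h w = altitudeSum-downs++ j h w

    altitudeSum-lowest : ∀ n → altitudeSum k 0 (lowest n k) ≡ 0
    altitudeSum-lowest zero    = refl
    altitudeSum-lowest (suc n) =
      trans (altitudeSum-downs++ k 0 (lowest n k)) (altitudeSum-lowest n)

    ups-downs++ : ∀ j w → ups (replicate j D ++ w) ≡ ups w
    ups-downs++ zero    w = refl
    ups-downs++ (suc j) w = ups-downs++ j w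

    ups-lowest : ∀ n → ups (lowest n k) ≡ n
    ups-lowest zero    = refl
    ups-lowest (suc n) = cong suc (trans (ups-downs++ k (lowest n k)) (ups-lowest n))

    -- The path has k·height > i while the lowest path has k·height ≤ i + k, so the lowest path
    -- cannot be a whole unit higher.
    lowest-below : ∀ n w i → Descends k 0 w → i < downs w →
                   height (lowest n k) i ≤ height w i
    lowest-below n w i d i<downs = ≮⇒≥ λ w<lowest → <-irrefl refl (begin-strict
      i + k                      <⟨ +-monoˡ-< k (height-Descends 0 w i d i<downs) ⟩
      k * height w i + k         ≡⟨ +-comm _ k ⟩
      k + k * height w i         ≡⟨ *-suc k (height w i) ⟨
      k * suc (height w i)       ≤⟨ *-monoʳ-≤ k w<lowest ⟩
      k * height (lowest n k) i  ≤⟨ height-lowest n i ⟩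
      i + k                      ∎)
      where open ≤-Reasoning

    -- The area is the difference of the column sums of `w` and of the lowest path. Their triangular
    -- terms agree, and the lowest path has altitude sum 0 because all its up steps start at the
    -- altitude 0.
    area≡altitudeSum : ∀ w → Descends k 0 w → area (ups w) k w ≡ altitudeSum k 0 w
    area≡altitudeSum w d = +-cancelʳ-≡ (k * triangular n) _ _ (begin
      area n k w + k * triangular n
        ≡⟨ cong₂ _+_ area≡∑ (sym sumHeights-lowest) ⟩
      sum (applyUpTo boxes (k * n)) + sum (applyUpTo (height (lowest n k)) (k * n))
        ≡⟨ sum-applyUpTo-+ (k * n) (λ i i<kn → length-filter-interval n id _
             (λ _ → mk⇔ id id)
             (lowest-below n w i d (subst (i <_) (sym downs≡) i<kn)) (height≤ups w i)) ⟩
      sum (applyUpTo (height w) (k * n))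
        ≡⟨ cong (λ N → sum (applyUpTo (height w) N)) downs≡ ⟨
      sumHeights w
        ≡⟨ sumHeights-Descends 0 w d ⟩
      altitudeSum k 0 w + k * triangular n ∎)
      where
      open ≡-Reasoning
      n = ups w

      downs≡ : downs w ≡ k * n
      downs≡ = downs-Descends k 0 w d

      boxes : ℕ → ℕ
      boxes i = length (filter (λ j → (height (lowest n k) i ≤? j) ×-dec (j <? height w i)) (upTo n))

      area≡∑ : area n k w ≡ sum (applyUpTo boxes (k * n))
      area≡∑ = trans (length-filter-cartesianProduct _ (upTo (k * n)) (upTo n))
                     (cong sum (map-upTo boxes (k * n)))

      downs-lowest : downs (lowest n k) ≡ k * n
      downs-lowest = trans (downs-Descends k 0 (lowest n k) (Descends-lowest n))
                           (cong (k *_) (ups-lowest n))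

      sumHeights-lowest : sum (applyUpTo (height (lowest n k)) (k * n)) ≡ k * triangular n
      sumHeights-lowest = begin
        sum (applyUpTo (height (lowest n k)) (k * n))
          ≡⟨ cong (λ N → sum (applyUpTo (height (lowest n k)) N)) downs-lowest ⟨
        sumHeights (lowest n k)
          ≡⟨ sumHeights-Descends 0 (lowest n k) (Descends-lowest n) ⟩
        altitudeSum k 0 (lowest n k) + k * triangular (ups (lowest n k))
          ≡⟨ cong₂ (λ a b → a + k * triangular b) (altitudeSum-lowest n) (ups-lowest n) ⟩
        k * triangular n ∎

-- Dilations, monomials and truncations of power series.

module SeriesProperties {c ℓ} (R : CommutativeRing c ℓ) where

  open CommutativeRing R hiding (zero)
  open Exp commutativeSemiring
  open PowerSeries R
  open Solver commutativeSemiring using (solve; _:=_; _:+_; _:*_; con)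
  open SetoidReasoning setoid
  private module S = CommutativeRing seriesRing
  open MonoidSum S.*-commutativeMonoid using () renaming (sum to product; sum-cong-≋ to product-cong)

  ⊠-congʳ : ∀ b {a a′} → a ≋ a′ → a ⊠ b ≋ a′ ⊠ b
  ⊠-congʳ b {a} {a′} a≋a′ = ⊠-cong {a} {b} {a′} {b} a≋a′ (λ _ → refl)

  [r]-cong : ∀ x {a b} → a ≋ b → a [ x r] ≋ b [ x r]
  [r]-cong x a≋b n = *-congˡ (a≋b n)

  [r]-∘ : ∀ x y a → a [ x r] [ y r] ≋ a [ y * x r]
  [r]-∘ x y a n = trans (sym (*-assoc _ _ _)) (*-congʳ (sym (^-distrib-* y x n)))

  [r]-comm : ∀ x y a → a [ x r] [ y r] ≋ a [ y r] [ x r]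
  [r]-comm x y a n = trans (sym (*-assoc _ _ _)) (trans (*-congʳ (*-comm _ _)) (*-assoc _ _ _))

  [r]-1# : ∀ x → S.1# [ x r] ≋ S.1#
  [r]-1# x zero    = *-identityˡ 1#
  [r]-1# x (suc n) = zeroʳ _

  shift-[r] : ∀ x a → shift (a [ x r]) ≋ λ n → x * (shift a [ x r]) n
  shift-[r] x a n = *-assoc _ _ _

  [r]-⊠ : ∀ x a b → (a ⊠ b) [ x r] ≋ a [ x r] ⊠ b [ x r]
  [r]-⊠ x a b zero = solve 2 (λ a b → con 1 :* (a :* b :+ con 0) :=
    con 1 :* a :* (con 1 :* b) :+ con 0) refl (a 0) (b 0)
  [r]-⊠ x a b (suc n) = begin
    x ^ suc n * (a 0 * b (suc n) + (shift a ⊠ b) n)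
      ≈⟨ solve 5 (λ x xⁿ a b t → x :* xⁿ :* (a :* b :+ t) := con 1 :* a :* (x :* xⁿ :* b) :+ x :* (xⁿ :* t))
           refl x (x ^ n) (a 0) (b (suc n)) ((shift a ⊠ b) n) ⟩
    (a [ x r]) 0 * (b [ x r]) (suc n) + x * ((shift a ⊠ b) [ x r]) n
      ≈⟨ +-congˡ (*-congˡ ([r]-⊠ x (shift a) b n)) ⟩
    (a [ x r]) 0 * (b [ x r]) (suc n) + x * (shift a [ x r] ⊠ b [ x r]) n
      ≈⟨ +-congˡ (scale-⊠ x (shift a [ x r]) (b [ x r]) n) ⟨
    (a [ x r]) 0 * (b [ x r]) (suc n) + ((λ i → x * (shift a [ x r]) i) ⊠ b [ x r]) n
      ≈⟨ +-congˡ (⊠-congʳ (b [ x r]) (shift-[r] x a) n) ⟨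
    (a [ x r] ⊠ b [ x r]) (suc n) ∎

  product-[r] : ∀ x {n} a → product {n} a [ x r] ≋ product {n} (λ j → a j [ x r])
  product-[r] x {zero}  a = [r]-1# x
  product-[r] x {suc n} a = S.trans ([r]-⊠ x (a Fin.zero) (product {n} (a ∘ Fin.suc)))
    (S.*-congˡ {a Fin.zero [ x r]} (product-[r] x {n} (a ∘ Fin.suc)))

  1^n≈1 : ∀ n → 1# ^ n ≈ 1#
  1^n≈1 zero    = refl
  1^n≈1 (suc n) = trans (*-identityˡ _) (1^n≈1 n)

  -- The factor for j = 0 is `a` itself, and every later factor contains one dilation by `x`, which
  -- is taken out of the product.
  product-[^r] : ∀ x a n → product {suc (suc n)} (λ j → a [ x ^ toℕ j r]) ≋
                 a ⊠ product {suc n} (λ j → a [ x ^ toℕ j r]) [ x r]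
  product-[^r] x a n = S.*-cong {a [ 1# r]} {a}
    (λ i → trans (*-congʳ (1^n≈1 i)) (*-identityˡ _))
    (S.trans (product-cong {suc n} (λ j i → sym ([r]-∘ (x ^ toℕ j) x a i)))
             (S.sym (product-[r] x {suc n} (λ j → a [ x ^ toℕ j r]))))

  -- Monomial x a means that a = x · r.
  Monomial : Carrier → Series → Set ℓ
  Monomial x a = a 0 ≈ 0# × shift a ≋ constant x

  Monomial-⊠-zero : ∀ {x} a b → Monomial x a → (a ⊠ b) 0 ≈ 0#
  Monomial-⊠-zero a b (a₀≈0 , _) = trans (+-identityʳ _) (trans (*-congʳ a₀≈0) (zeroˡ _))

  constant-⊠ : ∀ x b → constant x ⊠ b ≋ λ n → x * b n
  constant-⊠ x b n = begin
    (constant x ⊠ b) n                  ≈⟨ ⊠-congʳ b constant≋ n ⟩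
    ((λ i → x * constant 1# i) ⊠ b) n   ≈⟨ scale-⊠ x (constant 1#) b n ⟩
    x * (constant 1# ⊠ b) n             ≈⟨ *-congˡ (⊠-identityˡ b n) ⟩
    x * b n                             ∎
    where
    constant≋ : constant x ≋ λ i → x * constant 1# i
    constant≋ zero    = sym (*-identityʳ x)
    constant≋ (suc i) = sym (zeroʳ x)

  Monomial-⊠-suc : ∀ {x} a b n → Monomial x a → (a ⊠ b) (suc n) ≈ x * b n
  Monomial-⊠-suc {x} a b n (a₀≈0 , shift≋) = begin
    a 0 * b (suc n) + (shift a ⊠ b) n ≈⟨ +-cong (trans (*-congʳ a₀≈0) (zeroˡ _))
                                           (⊠-congʳ b shift≋ n) ⟩
    0# + (constant x ⊠ b) n           ≈⟨ +-identityˡ _ ⟩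
    (constant x ⊠ b) n                ≈⟨ constant-⊠ x b n ⟩
    x * b n                           ∎

  Monomial-variable : Monomial 1# variable-r
  Monomial-variable = refl , λ { zero → refl ; (suc _) → refl }

  -- Both `g [ s r]` and the part of `f [ s r]` beyond its constant 1 have this shape, so
  -- multiplication by them amounts to a shift and a scalar.
  Monomial-variable-⊠ : ∀ x y → Monomial (y * x) ((variable-r ⊠ constant x) [ y r])
  Monomial-variable-⊠ x y =
      trans (*-congˡ (Monomial-⊠-zero variable-r (constant x) Monomial-variable)) (zeroʳ _)
    , λ n → trans (*-congˡ (Monomial-⊠-suc variable-r (constant x) n Monomial-variable)) (coefficient n)
    where
    coefficient : ∀ n → y ^ suc n * (1# * constant x n) ≈ constant (y * x) n
    coefficient zero    = *-cong (*-identityʳ y) (*-identityˡ x)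
    coefficient (suc n) = trans (*-congˡ (zeroʳ 1#)) (zeroʳ _)

  -- Equality modulo r to the power n + 1. Products respect it, which permits induction on
  -- coefficients in the uniqueness proof.
  AgreeUpTo : ℕ → Series → Series → Set ℓ
  AgreeUpTo n a b = ∀ i → i ≤ n → a i ≈ b i

  AgreeUpTo-⊠ : ∀ n {a a′ b b′} → AgreeUpTo n a a′ → AgreeUpTo n b b′ → (a ⊠ b) n ≈ (a′ ⊠ b′) n
  AgreeUpTo-⊠ zero    a≈ b≈ = +-congʳ (*-cong (a≈ 0 z≤n) (b≈ 0 z≤n))
  AgreeUpTo-⊠ (suc n) a≈ b≈ = +-cong (*-cong (a≈ 0 z≤n) (b≈ (suc n) ℕ.≤-refl))
    (AgreeUpTo-⊠ n (λ i i≤n → a≈ (suc i) (s≤s i≤n)) (λ i i≤n → b≈ i (ℕ.m≤n⇒m≤1+n i≤n)))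

  AgreeUpTo-product : ∀ n {l a b} → (∀ j → AgreeUpTo n (a j) (b j)) →
                      AgreeUpTo n (product {l} a) (product {l} b)
  AgreeUpTo-product n {zero}  a≈b i i≤n = refl
  AgreeUpTo-product n {suc l} a≈b i i≤n = AgreeUpTo-⊠ i
    (λ j j≤i → a≈b Fin.zero j (ℕ.≤-trans j≤i i≤n))
    (λ j j≤i → AgreeUpTo-product n {l} (a≈b ∘ Fin.suc) j (ℕ.≤-trans j≤i i≤n))

-- Finite sums over lists and words.

module SumOver {c ℓ} (R : CommutativeRing c ℓ) (m s u : CommutativeRing.Carrier R) where

  open CommutativeRing R hiding (zero)
  open Identity R m s u using (sumOver)
  open Solver commutativeSemiring using (solve; _:=_; _:+_)

  module _ {A : Set} where

    sumOver-++ : ∀ (xs : List A) {ys} h → sumOver (xs ++ ys) h ≈ sumOver xs h + sumOver ys h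
    sumOver-++ []       h = sym (+-identityˡ _)
    sumOver-++ (x ∷ xs) h = trans (+-congˡ (sumOver-++ xs h)) (sym (+-assoc _ _ _))

    sumOver-map : ∀ {B : Set} (g : B → A) xs h → sumOver (map g xs) h ≈ sumOver xs (h ∘ g)
    sumOver-map g []       h = refl
    sumOver-map g (x ∷ xs) h = +-congˡ (sumOver-map g xs h)

    sumOver-cong : ∀ {xs : List A} {h h′} → All (λ x → h x ≈ h′ x) xs → sumOver xs h ≈ sumOver xs h′
    sumOver-cong []         = refl
    sumOver-cong (h≈ ∷ hs≈) = +-cong h≈ (sumOver-cong hs≈)

    sumOver-zero : ∀ {xs : List A} {h} → All (λ x → h x ≈ 0#) xs → sumOver xs h ≈ 0#
    sumOver-zero []         = refl
    sumOver-zero (h≈ ∷ hs≈) = trans (+-cong h≈ (sumOver-zero hs≈)) (+-identityʳ _)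

    sumOver-+ : ∀ (xs : List A) h h′ → sumOver xs (λ x → h x + h′ x) ≈ sumOver xs h + sumOver xs h′
    sumOver-+ []       h h′ = sym (+-identityʳ _)
    sumOver-+ (x ∷ xs) h h′ = trans (+-congˡ (sumOver-+ xs h h′))
      (solve 4 (λ a b c d → a :+ b :+ (c :+ d) := a :+ c :+ (b :+ d)) refl _ _ _ _)

    sumOver-* : ∀ (xs : List A) x h → sumOver xs (λ y → x * h y) ≈ x * sumOver xs h
    sumOver-* []       x h = sym (zeroʳ x)
    sumOver-* (y ∷ xs) x h = trans (+-congˡ (sumOver-* xs x h)) (sym (distribˡ x _ _))

    -- Rejected elements contribute zero to the unfiltered sum. This trades the sum over Dyck paths
    -- for a sum over all words.
    sumOver-filter : ∀ {P : Pred A Level.zero} (P? : Decidable P) {xs} h h′ →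
      All (λ x → (P x → h x ≈ h′ x) × (¬ P x → h′ x ≈ 0#)) xs →
      sumOver (filter P? xs) h ≈ sumOver xs h′
    sumOver-filter P? h h′ [] = refl
    sumOver-filter P? {x ∷ xs} h h′ ((h≈h′ , h′≈0) ∷ hs) with P? x
    ... | yes Px = +-cong (h≈h′ Px) (sumOver-filter P? h h′ hs)
    ... | no ¬Px = trans (sumOver-filter P? h h′ hs)
                         (trans (sym (+-identityˡ _)) (+-congʳ (sym (h′≈0 ¬Px))))

  sumOver-words-suc : ∀ ℓ h → sumOver (words (suc ℓ)) h ≈
                      sumOver (words ℓ) (h ∘ (U ∷_)) + sumOver (words ℓ) (h ∘ (D ∷_))
  sumOver-words-suc ℓ h = trans (sumOver-++ (map (U ∷_) (words ℓ)) h)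
    (+-cong (sumOver-map (U ∷_) (words ℓ) h) (sumOver-map (D ∷_) (words ℓ) h))

-- Weights of paths and their generating series.

module WeightedPaths {c ℓ} (R : CommutativeRing c ℓ) (m s u : CommutativeRing.Carrier R) (k : ℕ) where

  open CommutativeRing R hiding (zero)
  open Exp commutativeSemiring
  open LatticePaths
  open PowerSeries R
  open SeriesProperties R
  open SumOver R m s u
  open Identity R m s u
  open RingProperties ring
  open Solver commutativeSemiring using (solve; _:=_; _:+_; _:*_; con)
  open SetoidReasoning setoid
  open MonoidSum S.*-commutativeMonoid using ()
    renaming (sum to product; sum-cong-≋ to product-cong)

  peakWeight otherWeight : Carrier
  peakWeight  = (m′ + 1#) * (u′ + 1#)
  otherWeight = m′ * u′ + u′ + 1#

  beginsWithDowns : ℕ → List Step → Bool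
  beginsWithDowns j w = does (prefix? _≟ˢ_ (replicate j D) w)

  -- A word that goes below 0 or does not end at 0 gets the weight 0, so sums may run over all words
  -- of a given length.
  weight : ℕ → List Step → Carrier
  weight zero    []      = 1#
  weight (suc h) []      = 0#
  weight h       (U ∷ w) = s ^ h * (if beginsWithDowns k w then peakWeight else otherWeight)
                         * weight (k +ℕ h) w
  weight zero    (D ∷ w) = 0#
  weight (suc h) (D ∷ w) = weight h w

  weight-¬Descends : ∀ h w → ¬ Descends k h w → weight h w ≈ 0#
  weight-¬Descends zero    []      ¬d = contradiction ≡.refl ¬d
  weight-¬Descends (suc h) []      ¬d = refl
  weight-¬Descends zero    (U ∷ w) ¬d = trans (*-congˡ (weight-¬Descends _ w ¬d)) (zeroʳ _)
  weight-¬Descends (suc h) (U ∷ w) ¬d = trans (*-congˡ (weight-¬Descends _ w ¬d)) (zeroʳ _)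
  weight-¬Descends zero    (D ∷ w) ¬d = refl
  weight-¬Descends (suc h) (D ∷ w) ¬d = weight-¬Descends h w ¬d

  -- The clause of `weight` for `U` reduces only once the altitude is a constructor; this equation
  -- serves both cases.
  weight-U : ∀ h w → weight h (U ∷ w) ≡
    s ^ h * (if beginsWithDowns k w then peakWeight else otherWeight) * weight (k +ℕ h) w
  weight-U zero    w = ≡.refl
  weight-U (suc h) w = ≡.refl

  wtᴵ-U : ∀ w → wtᴵ (suc (ups w)) k (U ∷ w) ≈
          (if beginsWithDowns k w then peakWeight else otherWeight) * wtᴵ (ups w) k w
  wtᴵ-U w with prefix? _≟ˢ_ (replicate k D) w
  ... | yes _ = solve 5 (λ a b aᴾ bᴾ t → a :* aᴾ :* (b :* bᴾ) :* t := a :* b :* (aᴾ :* bᴾ :* t)) refl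
                  (m′ + 1#) (u′ + 1#) ((m′ + 1#) ^ Peak k w) ((u′ + 1#) ^ Peak k w)
                  (otherWeight ^ (ups w ∸ Peak k w))
  -- `Peak≤ups` turns `suc (ups w) ∸ Peak k w` into `suc (ups w ∸ Peak k w)`, which frees one factor
  -- `otherWeight`.
  ... | no _  = trans (*-congˡ (^-congʳ otherWeight (ℕ.+-∸-assoc 1 (Peak≤ups k w))))
                  (solve 3 (λ a q t → a :* (q :* t) := q :* (a :* t)) refl _ _ _)

  weight-Descends : ∀ h w → Descends k h w →
                    weight h w ≈ s ^ altitudeSum k h w * wtᴵ (ups w) k w
  weight-Descends zero    []      d = solve 0 (con 1 := con 1 :* (con 1 :* con 1 :* con 1)) refl
  weight-Descends h       (U ∷ w) d = begin
    weight h (U ∷ w)                     ≡⟨ weight-U h w ⟩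
    s ^ h * b * weight (k +ℕ h) w        ≈⟨ *-congˡ (weight-Descends (k +ℕ h) w d) ⟩
    s ^ h * b * (s ^ a * wtᴵ (ups w) k w)
      ≈⟨ solve 4 (λ x b y t → x :* b :* (y :* t) := x :* y :* (b :* t)) refl _ _ _ _ ⟩
    s ^ h * s ^ a * (b * wtᴵ (ups w) k w)
      ≈⟨ *-cong (^-homo-* s h a) (wtᴵ-U w) ⟨
    s ^ (h +ℕ a) * wtᴵ (suc (ups w)) k (U ∷ w) ∎
    where
    a = altitudeSum k (k +ℕ h) w
    b = if beginsWithDowns k w then peakWeight else otherWeight
  weight-Descends (suc h) (D ∷ w) d = weight-Descends h w d

  -- The coefficients of Hₕ in powers of t: with n up steps, a path from the altitude h to 0 has h +
  -- k n down steps, which gives the length.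
  pathSum : ℕ → Series
  pathSum h n = sumOver (words (h +ℕ n *ℕ suc k)) (weight h)

  pathSum≋dyckSum : pathSum 0 ≋ dyckSum k
  pathSum≋dyckSum n = begin
    sumOver (words (n *ℕ suc k)) (weight 0)
      ≡⟨ ≡.cong (λ l → sumOver (words l) (weight 0))
           (≡.trans (ℕ.*-suc n k) (≡.cong (n +ℕ_) (ℕ.*-comm n k))) ⟩
    sumOver (words (n +ℕ k *ℕ n)) (weight 0)
      ≈⟨ sumOver-filter (isDyck? n k) _ (weight 0)
           (All.map (λ {w} len → dyck w len , notDyck w len) (length-words (n +ℕ k *ℕ n))) ⟨
    dyckSum k n ∎
    where
    dyck : ∀ w → length w ≡ n +ℕ k *ℕ n → IsDyck n k w →
           s ^ area n k w * wtᴵ n k w ≈ weight 0 w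
    dyck w len isDyck with d ← Equivalence.to (IsDyck⇔Descends k n w len) isDyck
      -- Replaces `n` by `ups w`, the size for which the area and the weight are computed.
      with ≡.refl ← Descends⇒ups k n w len d
      = trans (*-congʳ (^-congʳ s (area≡altitudeSum k w d))) (sym (weight-Descends 0 w d))
    notDyck : ∀ w → length w ≡ n +ℕ k *ℕ n → ¬ IsDyck n k w → weight 0 w ≈ 0#
    notDyck w len ¬dyck =
      weight-¬Descends 0 w (¬dyck ∘ Equivalence.from (IsDyck⇔Descends k n w len))

  peakWeight≈ : peakWeight ≈ otherWeight + m′
  peakWeight≈ = solve 2 (λ m u → (m :+ con 1) :* (u :+ con 1) := m :* u :+ u :+ con 1 :+ m) refl m′ u′

  -- Only words that begin with j down steps survive, and these steps lead from the altitude j + h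
  -- to h.
  sumOver-beginsWithDowns : ∀ j h l →
    sumOver (words (j +ℕ l)) (λ w → if beginsWithDowns j w then weight (j +ℕ h) w else 0#)
      ≈ sumOver (words l) (weight h)
  sumOver-beginsWithDowns zero    h l = refl
  sumOver-beginsWithDowns (suc j) h l = begin
    sumOver (words (suc j +ℕ l)) _
      ≈⟨ sumOver-words-suc (j +ℕ l) _ ⟩
    sumOver (words (j +ℕ l)) (λ _ → 0#) + _
      ≈⟨ +-cong (sumOver-zero (All.universal (λ _ → refl) (words (j +ℕ l)))) (sumOver-beginsWithDowns j h l) ⟩
    0# + sumOver (words l) (weight h)
      ≈⟨ +-identityˡ _ ⟩
    sumOver (words l) (weight h) ∎

  afterUp : ℕ → Series
  afterUp h n = otherWeight * pathSum (k +ℕ h) n + m′ * pathSum h n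

  -- A peak weighs m′ more than another up step, and after a peak UDᵏ the path
  -- is back at the altitude h.
  sumOver-U : ∀ h n l → l ≡ k +ℕ h +ℕ n *ℕ suc k →
              sumOver (words l) (λ w → weight h (U ∷ w)) ≈ s ^ h * afterUp h n
  sumOver-U h n l ≡.refl = begin
    sumOver (words l) (λ w → weight h (U ∷ w))
      ≈⟨ sumOver-cong (All.universal expand (words l)) ⟩
    sumOver (words l) (λ w → s ^ h * (otherWeight * weight (k +ℕ h) w + m′ * peak w))
      ≈⟨ sumOver-* (words l) (s ^ h) _ ⟩
    s ^ h * sumOver (words l) (λ w → otherWeight * weight (k +ℕ h) w + m′ * peak w)
      ≈⟨ *-congˡ (trans (sumOver-+ (words l) _ _)
           (+-cong (sumOver-* (words l) otherWeight _) (sumOver-* (words l) m′ peak))) ⟩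
    s ^ h * (otherWeight * pathSum (k +ℕ h) n + m′ * sumOver (words l) peak)
      ≈⟨ *-congˡ (+-congˡ (*-congˡ sum-peak)) ⟩
    s ^ h * afterUp h n ∎
    where
    peak : List Step → Carrier
    peak w = if beginsWithDowns k w then weight (k +ℕ h) w else 0#

    expand : ∀ w → weight h (U ∷ w) ≈ s ^ h * (otherWeight * weight (k +ℕ h) w + m′ * peak w)
    expand w = trans (reflexive (weight-U h w)) (trans (*-assoc _ _ _) (*-congˡ split))
      where
      split : (if beginsWithDowns k w then peakWeight else otherWeight) * weight (k +ℕ h) w
              ≈ otherWeight * weight (k +ℕ h) w + m′ * peak w
      split with beginsWithDowns k w
      ... | true  = trans (*-congʳ peakWeight≈) (distribʳ _ _ _)
      ... | false = sym (trans (+-congˡ (zeroʳ m′)) (+-identityʳ _))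

    sum-peak : sumOver (words l) peak ≈ pathSum h n
    sum-peak rewrite ℕ.+-assoc k h (n *ℕ suc k) = sumOver-beginsWithDowns k h (h +ℕ n *ℕ suc k)

  -- The recurrence in the altitude and the number of up steps.

  pathSum-0-0 : pathSum 0 0 ≈ 1#
  pathSum-0-0 = +-identityʳ 1#

  -- After a first up step, only h letters are left, too few to descend from the altitude h + 1.
  pathSum-suc-0 : ∀ h → pathSum (suc h) 0 ≈ pathSum h 0
  pathSum-suc-0 h = trans (sumOver-words-suc (h +ℕ 0) (weight (suc h)))
    (trans (+-congʳ (sumOver-zero (All.map tooShort (length-words (h +ℕ 0))))) (+-identityˡ _))
    where
    tooShort : ∀ {w} → length w ≡ h +ℕ 0 → weight (suc h) (U ∷ w) ≈ 0#
    tooShort {w} len = weight-¬Descends (suc h) (U ∷ w) λ d → ℕ.<-irrefl ≡.refl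
      (ℕ.≤-trans (ℕ.m+n≤o⇒m≤o (suc h) (ℕ.≤-reflexive (≡.sym (downs-Descends k (suc h) (U ∷ w) d))))
      (ℕ.≤-trans (ℕ.m≤n+m (downs w) (ups w))
      (ℕ.≤-reflexive (≡.trans (≡.sym (length≡ups+downs w)) (≡.trans len (ℕ.+-identityʳ h))))))

  -- A down step from the altitude 0 weighs 0, and an up step there carries s⁰ = 1.
  pathSum-0-suc : ∀ n → pathSum 0 (suc n) ≈ afterUp 0 n
  pathSum-0-suc n = begin
    pathSum 0 (suc n)
      ≈⟨ sumOver-words-suc (k +ℕ n *ℕ suc k) (weight 0) ⟩
    sumOver (words (k +ℕ n *ℕ suc k)) (λ w → weight 0 (U ∷ w)) + sumOver (words (k +ℕ n *ℕ suc k)) (λ _ → 0#)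
      ≈⟨ +-cong (sumOver-U 0 n _ (≡.cong (_+ℕ n *ℕ suc k) (≡.sym (ℕ.+-identityʳ k))))
                (sumOver-zero (All.universal (λ _ → refl) (words (k +ℕ n *ℕ suc k)))) ⟩
    1# * afterUp 0 n + 0#
      ≈⟨ trans (+-identityʳ _) (*-identityˡ _) ⟩
    afterUp 0 n ∎

  pathSum-suc-suc : ∀ h n → pathSum (suc h) (suc n) ≈
                    pathSum h (suc n) + s ^ suc h * afterUp (suc h) n
  pathSum-suc-suc h n = trans (sumOver-words-suc (h +ℕ suc n *ℕ suc k) (weight (suc h)))
    (trans (+-congʳ (sumOver-U (suc h) n _ lengths)) (+-comm _ _))
    where
    lengths : h +ℕ suc n *ℕ suc k ≡ k +ℕ suc h +ℕ n *ℕ suc k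
    lengths = solveℕ 3 (λ h k t → h ⊹ (con′ 1 ⊹ (k ⊹ t)) ≗ k ⊹ (con′ 1 ⊹ h) ⊹ t) ≡.refl h k (n *ℕ suc k)
      where open +-*-Solver using () renaming (solve to solveℕ; _:+_ to _⊹_; _:=_ to _≗_; con to con′)

  -- The convolution identity and the product formula.

  afterUp-[r]-⊠ : ∀ x b h n → (afterUp h [ x r] ⊠ b) n ≈
    otherWeight * (pathSum (k +ℕ h) [ x r] ⊠ b) n + m′ * (pathSum h [ x r] ⊠ b) n
  afterUp-[r]-⊠ x b h n = begin
    (afterUp h [ x r] ⊠ b) n
      ≈⟨ ⊠-congʳ b {afterUp h [ x r]} {p ⊞ q} (λ i →
           solve 5 (λ y c a d e → y :* (c :* a :+ d :* e) := c :* (y :* a) :+ d :* (y :* e))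
             refl (x ^ i) otherWeight (pathSum (k +ℕ h) i) m′ (pathSum h i)) n ⟩
    ((p ⊞ q) ⊠ b) n
      ≈⟨ ⊠-distribʳ b p q n ⟩
    (p ⊠ b) n + (q ⊠ b) n
      ≈⟨ +-cong (scale-⊠ otherWeight (pathSum (k +ℕ h) [ x r]) b n)
                (scale-⊠ m′ (pathSum h [ x r]) b n) ⟩
    otherWeight * (pathSum (k +ℕ h) [ x r] ⊠ b) n + m′ * (pathSum h [ x r] ⊠ b) n ∎
    where
    p q : Series
    p i = otherWeight * (pathSum (k +ℕ h) [ x r]) i
    q i = m′ * (pathSum h [ x r]) i

  -- `afterUp` is a fixed linear combination of path sums at two altitudes, so the convolution
  -- identity at the index `n` passes to it. The identity is assumed at all altitudes because
  -- `k +ℕ h` occurs.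
  afterUp-suc : ∀ n h → (∀ h → (pathSum h [ s r] ⊠ pathSum 0) n ≈ pathSum (suc h) n) →
                (afterUp h [ s r] ⊠ pathSum 0) n ≈ afterUp (suc h) n
  afterUp-suc n h ih = trans (afterUp-[r]-⊠ s (pathSum 0) h n)
    (+-cong (*-congˡ (trans (ih (k +ℕ h))
                            (reflexive (≡.cong (λ h → pathSum h n) (≡.sym (ℕ.+-suc k h))))))
            (*-congˡ (ih h)))

  -- Cut a path from the altitude h + 1 at its first arrival at the altitude 0.
  -- Both sides satisfy the same recurrence in h and n.
  pathSum-suc : ∀ n h → (pathSum h [ s r] ⊠ pathSum 0) n ≈ pathSum (suc h) n
  pathSum-suc zero zero = begin
    1# * pathSum 0 0 * pathSum 0 0 + 0#
      ≈⟨ solve 2 (λ a b → con 1 :* a :* b :+ con 0 := a :* b) refl _ _ ⟩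
    pathSum 0 0 * pathSum 0 0   ≈⟨ *-congʳ pathSum-0-0 ⟩
    1# * pathSum 0 0            ≈⟨ *-identityˡ _ ⟩
    pathSum 0 0                 ≈⟨ pathSum-suc-0 0 ⟨
    pathSum 1 0                 ∎
  pathSum-suc zero (suc h) = begin
    (pathSum (suc h) [ s r] ⊠ pathSum 0) 0  ≈⟨ +-congʳ (*-congʳ (*-congˡ (pathSum-suc-0 h))) ⟩
    (pathSum h [ s r] ⊠ pathSum 0) 0        ≈⟨ pathSum-suc zero h ⟩
    pathSum (suc h) 0                       ≈⟨ pathSum-suc-0 (suc h) ⟨
    pathSum (suc (suc h)) 0                 ∎
  pathSum-suc (suc n) zero = begin
    1# * pathSum 0 0 * pathSum 0 (suc n) + (shift (pathSum 0 [ s r]) ⊠ pathSum 0) n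
      ≈⟨ +-cong (trans (*-congʳ (trans (*-identityˡ _) pathSum-0-0)) (*-identityˡ _))
                (⊠-congʳ (pathSum 0) (λ i → trans (*-congˡ (pathSum-0-suc i)) (*-assoc s (s ^ i) (afterUp 0 i))) n) ⟩
    pathSum 0 (suc n) + ((λ i → s * (afterUp 0 [ s r]) i) ⊠ pathSum 0) n
      ≈⟨ +-congˡ (scale-⊠ s (afterUp 0 [ s r]) (pathSum 0) n) ⟩
    pathSum 0 (suc n) + s * (afterUp 0 [ s r] ⊠ pathSum 0) n
      -- The factor `s` released by the shift is the weight `s ^ 1` of an up step at the altitude 1.
      ≈⟨ +-congˡ (*-cong (sym (*-identityʳ s)) (afterUp-suc n 0 (pathSum-suc n))) ⟩
    pathSum 0 (suc n) + s ^ 1 * afterUp 1 n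
      ≈⟨ pathSum-suc-suc 0 n ⟨
    pathSum 1 (suc n) ∎
  pathSum-suc (suc n) (suc h) = begin
    1# * pathSum (suc h) 0 * pathSum 0 (suc n) + (shift (pathSum (suc h) [ s r]) ⊠ pathSum 0) n
      ≈⟨ +-cong (*-congʳ (*-congˡ (pathSum-suc-0 h)))
                (⊠-congʳ (pathSum 0) expand n) ⟩
    1# * pathSum h 0 * pathSum 0 (suc n)
      + ((shift (pathSum h [ s r]) ⊞ λ i → x * (afterUp (suc h) [ s r]) i) ⊠ pathSum 0) n
      ≈⟨ +-congˡ (trans (⊠-distribʳ (pathSum 0) (shift (pathSum h [ s r]))
                          (λ i → x * (afterUp (suc h) [ s r]) i) n)
                        (+-congˡ (scale-⊠ x (afterUp (suc h) [ s r]) (pathSum 0) n))) ⟩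
    1# * pathSum h 0 * pathSum 0 (suc n)
      + ((shift (pathSum h [ s r]) ⊠ pathSum 0) n + x * (afterUp (suc h) [ s r] ⊠ pathSum 0) n)
      -- The first two summands recombine into the coefficient n + 1 for the altitude h: an
      -- induction on h runs inside the induction on n.
      ≈⟨ +-assoc _ _ _ ⟨
    (pathSum h [ s r] ⊠ pathSum 0) (suc n) + x * (afterUp (suc h) [ s r] ⊠ pathSum 0) n
      ≈⟨ +-cong (pathSum-suc (suc n) h) (*-congˡ (afterUp-suc n (suc h) (pathSum-suc n))) ⟩
    pathSum (suc h) (suc n) + x * afterUp (suc (suc h)) n
      ≈⟨ pathSum-suc-suc (suc h) n ⟨
    pathSum (suc (suc h)) (suc n) ∎
    where
    -- The shift of the dilated series releases one factor `s`, which lifts the step weight from the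
    -- altitude h + 1 to h + 2.
    x = s ^ suc (suc h)
    expand : shift (pathSum (suc h) [ s r]) ≋
             shift (pathSum h [ s r]) ⊞ λ i → x * (afterUp (suc h) [ s r]) i
    expand i = trans (*-congˡ (pathSum-suc-suc h i))
      (solve 5 (λ y yⁱ p yʰ e → y :* yⁱ :* (p :+ yʰ :* e) := y :* yⁱ :* p :+ y :* yʰ :* (yⁱ :* e))
         refl s (s ^ i) (pathSum h (suc i)) (s ^ suc h) (afterUp (suc h) i))

  -- Iterate Hₕ₊₁(t) = Hₕ(st) H₀(t): each round dilates the factors already present by `s`.
  pathSum-product : ∀ h → pathSum h ≋ product {suc h} (λ j → pathSum 0 [ s ^ toℕ j r])
  pathSum-product zero    n = begin
    pathSum 0 n                      ≈⟨ trans (*-congʳ (1^n≈1 n)) (*-identityˡ _) ⟨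
    (pathSum 0 [ 1# r]) n            ≈⟨ S.*-identityʳ (pathSum 0 [ 1# r]) n ⟨
    (pathSum 0 [ 1# r] ⊠ S.1#) n     ∎
  pathSum-product (suc h) n = begin
    pathSum (suc h) n
      ≈⟨ pathSum-suc n h ⟨
    (pathSum h [ s r] ⊠ pathSum 0) n
      ≈⟨ ⊠-comm (pathSum h [ s r]) (pathSum 0) n ⟩
    (pathSum 0 ⊠ pathSum h [ s r]) n
      ≈⟨ ⊠-cong {a = pathSum 0} (λ _ → refl) ([r]-cong s (pathSum-product h)) n ⟩
    (pathSum 0 ⊠ product {suc h} (λ j → pathSum 0 [ s ^ toℕ j r]) [ s r]) n
      ≈⟨ product-[^r] s (pathSum 0) h n ⟨
    product {suc (suc h)} (λ j → pathSum 0 [ s ^ toℕ j r]) n ∎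

  -- The substitutions r ↦ -sr and r ↦ sʲr commute and the first is multiplicative, so the product
  -- formula for Hₖ passes to the signed series.
  dyckSeries-product : product {suc k} (λ j → dyckSeries k [ s ^ toℕ j r]) ≋ pathSum k [ - s r]
  dyckSeries-product n = begin
    product {suc k} (λ j → dyckSeries k [ s ^ toℕ j r]) n
      ≈⟨ product-cong {suc k} (λ j → [r]-comm (- s) (s ^ toℕ j) (dyckSum k)) n ⟩
    product {suc k} (λ j → dyckSum k [ s ^ toℕ j r] [ - s r]) n
      ≈⟨ product-[r] (- s) {suc k} (λ j → dyckSum k [ s ^ toℕ j r]) n ⟨
    (product {suc k} (λ j → dyckSum k [ s ^ toℕ j r]) [ - s r]) n
      ≈⟨ [r]-cong (- s) (product-cong {suc k} (λ j → [r]-cong (s ^ toℕ j) pathSum≋dyckSum)) n ⟨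
    (product {suc k} (λ j → pathSum 0 [ s ^ toℕ j r]) [ - s r]) n
      ≈⟨ [r]-cong (- s) (pathSum-product k) n ⟨
    (pathSum k [ - s r]) n ∎

  -- The functional equation, coefficient by coefficient.

  gCoefficient : Carrier
  gCoefficient = m * (u - 1#) + 1#

  otherWeight≈gCoefficient : otherWeight ≈ gCoefficient
  otherWeight≈gCoefficient = begin
    m′ * u′ + u′ + 1#     ≈⟨ solve 2 (λ m u → m :* u :+ u :+ con 1 := (m :+ con 1) :* u :+ con 1) refl m′ u′ ⟩
    (m′ + 1#) * u′ + 1#   ≈⟨ +-congʳ (*-congʳ m′+1≈m) ⟩
    m * u′ + 1#           ∎
    where
    m′+1≈m : m′ + 1# ≈ m
    m′+1≈m = trans (+-assoc m (- 1#) 1#) (trans (+-congˡ (-‿inverseˡ 1#)) (+-identityʳ m))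

  private
    f-1 : Series
    f-1 = (variable-r ⊠ constant m′) [ s r]

    f[sr] : f [ s r] ≋ S.1# ⊞ f-1
    f[sr] n = trans (distribˡ _ _ _) (+-congʳ ([r]-1# s n))

  f-⊠-0 : ∀ ν → (f [ s r] ⊠ ν) 0 ≈ ν 0
  f-⊠-0 ν = begin
    (f [ s r] ⊠ ν) 0            ≈⟨ ⊠-congʳ ν f[sr] 0 ⟩
    ((S.1# ⊞ f-1) ⊠ ν) 0        ≈⟨ ⊠-distribʳ ν S.1# f-1 0 ⟩
    (S.1# ⊠ ν) 0 + (f-1 ⊠ ν) 0  ≈⟨ +-cong (⊠-identityˡ ν 0) (Monomial-⊠-zero f-1 ν (Monomial-variable-⊠ m′ s)) ⟩
    ν 0 + 0#                    ≈⟨ +-identityʳ _ ⟩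
    ν 0                         ∎

  f-⊠-suc : ∀ ν n → (f [ s r] ⊠ ν) (suc n) ≈ ν (suc n) + s * m′ * ν n
  f-⊠-suc ν n = begin
    (f [ s r] ⊠ ν) (suc n)                  ≈⟨ ⊠-congʳ ν f[sr] (suc n) ⟩
    ((S.1# ⊞ f-1) ⊠ ν) (suc n)              ≈⟨ ⊠-distribʳ ν S.1# f-1 (suc n) ⟩
    (S.1# ⊠ ν) (suc n) + (f-1 ⊠ ν) (suc n)  ≈⟨ +-cong (⊠-identityˡ ν (suc n))
                                                 (Monomial-⊠-suc f-1 ν n (Monomial-variable-⊠ m′ s)) ⟩
    ν (suc n) + s * m′ * ν n                ∎

  1-g-⊠-0 : ∀ a → (S.1# S.- g [ s r] S.* a) 0 ≈ 1#
  1-g-⊠-0 a = trans (+-congˡ (trans (-‿cong (Monomial-⊠-zero (g [ s r]) a (Monomial-variable-⊠ gCoefficient s))) -0#≈0#))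
                    (+-identityʳ 1#)

  1-g-⊠-suc : ∀ a n → (S.1# S.- g [ s r] S.* a) (suc n) ≈ - (s * gCoefficient * a n)
  1-g-⊠-suc a n = trans (+-identityˡ _)
    (-‿cong (Monomial-⊠-suc (g [ s r]) a n (Monomial-variable-⊠ gCoefficient s)))

  -- Coefficientwise this is H₀ = 1 + t E₀, with the term m′ H₀ of E₀ moved to the left into `f` and
  -- Hₖ replaced by the product.
  dyckSeries-satisfies : Satisfies k (dyckSeries k)
  dyckSeries-satisfies zero = begin
    (f [ s r] ⊠ dyckSeries k) 0   ≈⟨ f-⊠-0 (dyckSeries k) ⟩
    1# * dyckSum k 0              ≈⟨ *-identityˡ _ ⟩
    dyckSum k 0                   ≈⟨ pathSum≋dyckSum 0 ⟨
    pathSum 0 0                   ≈⟨ pathSum-0-0 ⟩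
    1#                            ≈⟨ 1-g-⊠-0 (product {suc k} (λ j → dyckSeries k [ s ^ toℕ j r])) ⟨
    _                             ∎
  dyckSeries-satisfies (suc n) = begin
    (f [ s r] ⊠ dyckSeries k) (suc n)
      ≈⟨ f-⊠-suc (dyckSeries k) n ⟩
    t * tⁿ * dyckSum k (suc n) + s * m′ * (tⁿ * dyckSum k n)
      ≈⟨ +-cong (*-congˡ (trans (sym (pathSum≋dyckSum (suc n))) (pathSum-0-suc n)))
                (*-congˡ (*-congˡ (sym (pathSum≋dyckSum n)))) ⟩
    t * tⁿ * (otherWeight * pathSum (k +ℕ 0) n + m′ * b) + s * m′ * (tⁿ * b)
      ≈⟨ +-congʳ (*-congˡ (+-congʳ (*-cong otherWeight≈gCoefficient
           (reflexive (≡.cong (λ h → pathSum h n) (ℕ.+-identityʳ k)))))) ⟩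
    t * tⁿ * (gCoefficient * a + m′ * b) + s * m′ * (tⁿ * b)
      -- The two terms with m′ are collected under the factor `t + s`, which vanishes because t =
      -- -s.
      ≈⟨ solve 7 (λ s t tⁿ q a m b → t :* tⁿ :* (q :* a :+ m :* b) :+ s :* m :* (tⁿ :* b) :=
                   t :* (q :* (tⁿ :* a)) :+ (t :+ s) :* (m :* tⁿ :* b))
           refl s t tⁿ gCoefficient a m′ b ⟩
    t * (gCoefficient * (tⁿ * a)) + (t + s) * (m′ * tⁿ * b)
      ≈⟨ +-congˡ (trans (*-congʳ (-‿inverseˡ s)) (zeroˡ _)) ⟩
    t * (gCoefficient * (tⁿ * a)) + 0#
      ≈⟨ +-identityʳ _ ⟩
    - s * (gCoefficient * (tⁿ * a))
      ≈⟨ -‿distribˡ-* s _ ⟨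
    - (s * (gCoefficient * (tⁿ * a)))
      ≈⟨ -‿cong (*-assoc s gCoefficient (tⁿ * a)) ⟨
    - (s * gCoefficient * (tⁿ * a))
      ≈⟨ -‿cong (*-congˡ (dyckSeries-product n)) ⟨
    - (s * gCoefficient * Π n)
      ≈⟨ 1-g-⊠-suc Π n ⟨
    _ ∎
    where
    t  = - s
    tⁿ = t ^ n
    a  = pathSum k n
    b  = pathSum 0 n
    Π  = product {suc k} (λ j → dyckSeries k [ s ^ toℕ j r])

  -- The equation determines the coefficient n + 1 from those up to n, because `g [ s r]` is a
  -- multiple of r and `f [ s r]` has constant term 1.
  Satisfies-unique : ∀ ν ν₁ → Satisfies k ν → Satisfies k ν₁ → ν ≋ ν₁
  Satisfies-unique ν ν₁ sat sat₁ n = agree n n ℕ.≤-refl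
    where
    Π : Series → Series
    Π ν = product {suc k} (λ j → ν [ s ^ toℕ j r])

    initial : ∀ ν → Satisfies k ν → ν 0 ≈ 1#
    initial ν sat = trans (sym (f-⊠-0 ν)) (trans (sat 0) (1-g-⊠-0 (Π ν)))

    next : ∀ ν → Satisfies k ν → ∀ n → ν (suc n) + s * m′ * ν n ≈ - (s * gCoefficient * Π ν n)
    next ν sat n = trans (sym (f-⊠-suc ν n)) (trans (sat (suc n)) (1-g-⊠-suc (Π ν) n))

    agree : ∀ n → AgreeUpTo n ν ν₁
    agree zero    zero    z≤n = trans (initial ν sat) (sym (initial ν₁ sat₁))
    agree (suc n) i       i≤  with ℕ.m≤n⇒m<n∨m≡n i≤
    ... | inj₁ (s≤s i≤n) = agree n i i≤n
    -- The lower term coming from `f` agrees by induction and is cancelled; the products agree at n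
    -- since only coefficients up to n enter.
    ... | inj₂ ≡.refl    = +-cancelʳ (s * m′ * ν n) _ _ (begin
      ν (suc n) + s * m′ * ν n        ≈⟨ next ν sat n ⟩
      - (s * gCoefficient * Π ν n)    ≈⟨ -‿cong (*-congˡ (AgreeUpTo-product n {suc k}
                                           (λ j i i≤n → *-congˡ {(s ^ toℕ j) ^ i} (agree n i i≤n)) n ℕ.≤-refl)) ⟩
      - (s * gCoefficient * Π ν₁ n)   ≈⟨ next ν₁ sat₁ n ⟨
      ν₁ (suc n) + s * m′ * ν₁ n      ≈⟨ +-congˡ (*-congˡ (agree n n ℕ.≤-refl)) ⟨
      ν₁ (suc n) + s * m′ * ν n       ∎)

  satisfies⇒≋dyckSeries : ∀ ν → Satisfies k ν → ν ≋ dyckSeries k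
  satisfies⇒≋dyckSeries ν sat = Satisfies-unique ν (dyckSeries k) sat dyckSeries-satisfies

  -- The variable ν is essential: instantiated at ℤ[m,s,u], dyckSeries-satisfies makes the
  -- conversion checker unfold the Dyck sums.
  ≋dyckSeries⇒satisfies : ∀ ν → ν ≋ dyckSeries k → Satisfies k ν
  ≋dyckSeries⇒satisfies ν ν≋ = S.trans (S.*-congˡ {f [ s r]} ν≋) (S.trans dyckSeries-satisfies
    (S.+-congˡ (S.-‿cong (S.*-congˡ {g [ s r]}
      (product-cong {suc k} λ j → [r]-cong (s ^ toℕ j) λ n → sym (ν≋ n))))))

-- The solution over ℤ[m,s,u].

open import Defs using (Satisfies; dyckSeries; Series; _≋_)

proposition4p17 : (k : ℕ) → 1 ≤ k →
    ∃! _≋_ (Satisfies k) ×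
    ((ν : Series) → Satisfies k ν → ν ≋ dyckSeries k)
proposition4p17 k _ =
  ( dyckSeries k
  , ≋dyckSeries⇒satisfies (dyckSeries k) (S.refl {dyckSeries k})
  , λ {ν} sat → S.sym {ν} {dyckSeries k} (satisfies⇒≋dyckSeries ν sat)
  ) , satisfies⇒≋dyckSeries
  where
  module S = CommutativeRing (PowerSeries.seriesRing ℤ[m,s,u])
  open WeightedPaths ℤ[m,s,u] var-m var-s var-u k
    using (≋dyckSeries⇒satisfies; satisfies⇒≋dyckSeries)
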